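{- Let $Fa$ and $Fb$ be two distinct points of $\mathrm{PG}(n-1,q)$ ($a,b\in L^*$), and let $\ell$ be the line joining them. Put $m=[F(ab^{ -1}):F]$, the degree of the field extension of $F$ generated by $ab^{ -1}$. Then $j(\ell)$ is the image of an $(m-1)$-uple embedding.
   Context: Let $q$ be a prime power, $F=\mathbb F_q$, $n\ge 2$ an integer, and $L=\mathbb F_{q^n}\supseteq F$. Regard $L$ as an $n$-dimensional $F$-vector space; $\mathrm{PG}(n-1,q)$ denotes the projective space whose points are the one-dimensional $F$-subspaces $Fx$, $x\in L^*$, and whose lines are the two-dimensional $F$-subspaces (identified with their sets of points). Define $j:\mathrm{PG}(n-1,q)\to\mathrm{PG}(n-1,q)$ by $j(Fx)=Fx^{ -1}$. For an integer $r\ge1$, a set $X$ of points of a projective space $\mathrm{PG}(V)$ over $F$ is called the image of an $r$-uple embedding if there is an injective $F$-linear map $\phi:F^{r+1}\to V$ such that $X=\{F\,\phi(t_0^r,t_0^{r-1}t_1,\dots,t_0t_1^{r-1},t_1^r):(t_0,t_1)\in F^2\setminus\{(0,0)\}\}$. -}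

module Defs where

open import Algebra.Apartness.Bundles using (HeytingField; HeytingCommutativeRing)
open import Algebra.Bundles using (CommutativeRing; Ring; Semiring)
open import Algebra.Definitions using (Invertible)
open import Algebra.Module.Bundles using (LeftModule)
open import Algebra.Module.Bundles.Raw using (RawLeftModule)
open import Algebra.Module.Morphism.Structures using (IsLeftModuleMonomorphism)
open import Algebra.Morphism.Structures using (IsRingMonomorphism)
import Algebra.Definitions.RawMonoid as RawMonoidDefinitions
import Algebra.Definitions.RawSemiring as RawSemiringDefinitions
import Algebra.Properties.Ring as RingProperties
open import Data.Fin.Base using (Fin; toℕ)
open import Data.Fin.Properties using (any?)
import Data.Fin.Properties as Fin
open import Data.Nat.Base using (ℕ; _∸_; _≤_; _^_)
open import Data.Nat.Primality using (Prime)
open import Data.Product.Base using (∃-syntax; _×_; _,_; proj₁; proj₂)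
open import Data.Vec.Functional using (Vector)
open import Function.Base using (id)
open import Function.Bundles using (Func; Inverse; _⇔_)
open import Level using (Level; _⊔_)
open import Relation.Binary.Bundles using (Setoid)
open import Relation.Binary.Definitions using (Decidable)
import Relation.Binary.PropositionalEquality.Core as ≡
import Relation.Binary.PropositionalEquality.Properties as ≡
import Relation.Binary.Reasoning.Setoid as SetoidReasoning
open import Relation.Nullary using (¬_; yes; no; contradiction)
open import Relation.Nullary.Decidable using (map′)
open import Relation.Unary using (Pred; _∈_; _⊆_; _≐_)

private
  variable
    c ℓ ℓ# m ℓm : Level

IsPrimePower : ℕ → Set
IsPrimePower q = ∃[ p ] ∃[ k ] Prime p × 1 ≤ k × q ≡.≡ p ^ k

-- A field with exactly q elements.  A Heyting field is automatically nontrivial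
-- (if 0 ≈ 1 then 0 is invertible, so 0 # 0).
record FiniteField c ℓ ℓ# (q : ℕ) : Set (Level.suc (c ⊔ ℓ ⊔ ℓ#)) where
  field
    heytingField : HeytingField c ℓ ℓ#

  open HeytingField heytingField using (heytingCommutativeRing; _#_; tight; #⇒invertible; invertible⇒#; _-_)
  open HeytingCommutativeRing heytingCommutativeRing public using (commutativeRing)
  open CommutativeRing commutativeRing public hiding (_-_)

  field
    enumeration : Inverse setoid (≡.setoid (Fin q))

  private
    module E = Inverse enumeration

  infix 4 _≟_
  _≟_ : Decidable _≈_
  x ≟ y = map′ (λ e → trans (sym (E.strictlyInverseʳ x)) (trans (E.from-cong e) (E.strictlyInverseʳ y)))
               E.to-cong (Fin._≟_ (E.to x) (E.to y))

  -- The library's apartness is not assumed to coincide with ≉; finiteness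
  -- makes invertibility decidable, so every x ≉ 0 is invertible.
  ≉0⇒invertible : ∀ x → x ≉ 0# → Invertible _≈_ 1# _*_ x
  ≉0⇒invertible x x≉0 with any? (λ i → (E.from i * x) ≟ 1#)
  ... | yes (i , eq) = E.from i , eq , trans (*-comm _ _) eq
  ... | no ¬inv = contradiction (proj₁ (tight x 0#) ¬x#0) x≉0
    where
    x-0≈x : (x - 0#) ≈ x
    x-0≈x = trans (+-congˡ (RingProperties.-0#≈0# ring)) (+-identityʳ x)

    ¬x#0 : ¬ (x # 0#)
    ¬x#0 x#0 with #⇒invertible x#0
    ... | y , yx≈1 , _ = ¬inv (E.to y ,
      trans (*-cong (E.strictlyInverseʳ y) (sym x-0≈x)) yx≈1)

  inv : ∀ x → x ≉ 0# → Carrier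
  inv x x≉0 = proj₁ (≉0⇒invertible x x≉0)

  invˡ : ∀ x (x≉0 : x ≉ 0#) → inv x x≉0 * x ≈ 1#
  invˡ x x≉0 = proj₁ (proj₂ (≉0⇒invertible x x≉0))

  1≉0 : 1# ≉ 0#
  1≉0 1≈0 = HeytingField.#-irrefl heytingField refl
    (invertible⇒# {0#} {0#} (0# , all≈ , all≈))
    where
    all≈ : ∀ {x} → x ≈ 1#
    all≈ {x} = trans (trans (trans (sym (*-identityˡ x)) (*-congʳ 1≈0)) (zeroˡ x)) (sym 1≈0)

  inv≉0 : ∀ x (x≉0 : x ≉ 0#) → inv x x≉0 ≉ 0#
  inv≉0 x x≉0 eq = 1≉0 (trans (sym (invˡ x x≉0)) (trans (*-congʳ eq) (zeroˡ x)))

-- Linear algebra and projective geometry of a vector space V over F.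
module ProjectiveSpace {q : ℕ} (F : FiniteField c ℓ ℓ# q)
                       (V : LeftModule (FiniteField.ring F) m ℓm) where
  private
    module F = FiniteField F
  open LeftModule V
  open RawMonoidDefinitions +ᴹ-rawMonoid using (sum)
  open RawSemiringDefinitions (Semiring.rawSemiring F.semiring) using () renaming (_^_ to _^ꟳ_)

  linearCombination : ∀ {d} → Vector F.Carrier d → Vector Carrierᴹ d → Carrierᴹ
  linearCombination α v = sum (λ i → α i *ₗ v i)

  record IsBasis {p d} (v : Vector Carrierᴹ d) (W : Pred Carrierᴹ p)
         : Set (c ⊔ ℓ ⊔ m ⊔ ℓm ⊔ p) where
    field
      independent : ∀ α → linearCombination α v ≈ᴹ 0ᴹ → ∀ i → α i F.≈ F.0#
      spans       : ∀ x → x ∈ W ⇔ (∃[ α ] x ≈ᴹ linearCombination α v)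

  -- In particular W is a subspace, being the set of linear combinations of the basis.
  HasDimension : ∀ {p} → Pred Carrierᴹ p → ℕ → Set (c ⊔ ℓ ⊔ m ⊔ ℓm ⊔ p)
  HasDimension W d = ∃[ v ] IsBasis {d = d} v W

  -- The subspace F x.
  ⟨_⟩ : Carrierᴹ → Pred Carrierᴹ (c ⊔ ℓm)
  ⟨ x ⟩ y = ∃[ α ] y ≈ᴹ α *ₗ x

  -- A one-dimensional subspace F x, given by a representative x; two
  -- representatives are the same point when they span the same subspace.
  record Point : Set (m ⊔ ℓm) where
    constructor point
    field
      vector  : Carrierᴹ
      nonzero : vector ≉ᴹ 0ᴹ
  open Point public

  pointSetoid : Setoid (m ⊔ ℓm) (c ⊔ m ⊔ ℓm)
  pointSetoid = record
    { Carrier = Point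
    ; _≈_ = λ P Q → ⟨ vector P ⟩ ≐ ⟨ vector Q ⟩
    ; isEquivalence = record
      { refl  = id , id
      ; sym   = λ (f , g) → g , f
      ; trans = λ (f , g) (f′ , g′) → (λ z → f′ (f z)) , (λ z → g (g′ z))
      }
    }

  open Setoid pointSetoid public using () renaming (_≈_ to _≈ₚ_; _≉_ to _≉ₚ_)

  record Line p : Set (c ⊔ ℓ ⊔ m ⊔ ℓm ⊔ Level.suc p) where
    field
      subspace    : Pred Carrierᴹ p
      dimension-2 : HasDimension subspace 2

  pointsOf : ∀ {p} → Line p → Pred Point (c ⊔ m ⊔ ℓm ⊔ p)
  pointsOf l P = ⟨ vector P ⟩ ⊆ Line.subspace l

  F^ : ℕ → RawLeftModule F.Carrier c ℓ
  F^ d = record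
    { Carrierᴹ = Vector F.Carrier d
    ; _≈ᴹ_     = λ u v → ∀ i → u i F.≈ v i
    ; _+ᴹ_     = λ u v i → u i F.+ v i
    ; _*ₗ_     = λ α v i → α F.* v i
    ; 0ᴹ       = λ _ → F.0#
    ; -ᴹ_      = λ v i → F.- v i
    }

  monomials : ∀ r → F.Carrier → F.Carrier → Vector F.Carrier (ℕ.suc r)
  monomials r t₀ t₁ i = (t₀ ^ꟳ (r ∸ toℕ i)) F.* (t₁ ^ꟳ toℕ i)

  IsImageOfUpleEmbedding : ∀ {p} → ℕ → Pred Point p → Set (c ⊔ ℓ ⊔ m ⊔ ℓm ⊔ p)
  IsImageOfUpleEmbedding r X = 1 ≤ r × (∃[ φ ]
    IsLeftModuleMonomorphism (F^ (ℕ.suc r)) rawLeftModule φ ×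
    (∀ P → P ∈ X ⇔ (∃[ t₀ ] ∃[ t₁ ] ¬ (t₀ F.≈ F.0# × t₁ F.≈ F.0#) ×
                      ⟨ vector P ⟩ ≐ ⟨ φ (monomials r t₀ t₁) ⟩)))

module Extension {c′ ℓ′ ℓ#′ : Level} {q q′ : ℕ}
                 (F : FiniteField c ℓ ℓ# q) (L : FiniteField c′ ℓ′ ℓ#′ q′)
                 (ι : FiniteField.Carrier F → FiniteField.Carrier L)
                 (ι-mono : IsRingMonomorphism (Ring.rawRing (FiniteField.ring F))
                                              (Ring.rawRing (FiniteField.ring L)) ι) where
  private
    module F = FiniteField F
    module ι = IsRingMonomorphism ι-mono
  open FiniteField L

  asVectorSpace : LeftModule F.ring c′ ℓ′
  asVectorSpace = record
    { Carrierᴹ = Carrier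
    ; _≈ᴹ_ = _≈_
    ; _+ᴹ_ = _+_
    ; _*ₗ_ = λ α x → ι α * x
    ; 0ᴹ = 0#
    ; -ᴹ_ = -_
    ; isLeftModule = record
      { isLeftSemimodule = record
        { +ᴹ-isCommutativeMonoid = +-isCommutativeMonoid
        ; isPreleftSemimodule = record
          { *ₗ-cong      = λ α≈β x≈y → *-cong (ι.⟦⟧-cong α≈β) x≈y
          ; *ₗ-zeroˡ     = λ x → trans (*-congʳ ι.0#-homo) (zeroˡ x)
          ; *ₗ-distribʳ  = λ x α β → trans (*-congʳ (ι.+-homo α β)) (distribʳ x _ _)
          ; *ₗ-identityˡ = λ x → trans (*-congʳ ι.1#-homo) (*-identityˡ x)
          ; *ₗ-assoc     = λ α β x → trans (*-congʳ (ι.*-homo α β)) (*-assoc _ _ x)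
          ; *ₗ-zeroʳ     = λ α → zeroʳ (ι α)
          ; *ₗ-distribˡ  = λ α → distribˡ (ι α)
          }
        }
      ; -ᴹ‿cong = -‿cong
      ; -ᴹ‿inverse = -‿inverse
      }
    }

  open ProjectiveSpace F asVectorSpace public

  j : Func pointSetoid pointSetoid
  j = record
    { to   = λ (point x x≉0) → point (inv x x≉0) (inv≉0 x x≉0)
    ; cong = λ {P} {Q} (P⊆Q , Q⊆P) → half P Q (Q⊆P (self Q)) , half Q P (P⊆Q (self P))
    }
    where
    open SetoidReasoning setoid

    self : ∀ P → vector P ∈ ⟨ vector P ⟩
    self P = F.1# , sym (trans (*-congʳ ι.1#-homo) (*-identityˡ _))

    half : ∀ P Q → vector Q ∈ ⟨ vector P ⟩ →
           ⟨ inv (vector P) (nonzero P) ⟩ ⊆ ⟨ inv (vector Q) (nonzero Q) ⟩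
    half (point x x≉0) (point y y≉0) (β , y≈βx) {z} (γ , z≈γx⁻¹) = γ F.* β , (begin
      z                          ≈⟨ z≈γx⁻¹ ⟩
      ι γ * x⁻¹                  ≈⟨ *-congˡ x⁻¹≈βy⁻¹ ⟩
      ι γ * (ι β * y⁻¹)          ≈⟨ *-assoc _ _ _ ⟨
      ι γ * ι β * y⁻¹            ≈⟨ *-congʳ (ι.*-homo γ β) ⟨
      ι (γ F.* β) * y⁻¹          ∎)
      where
      x⁻¹ = inv x x≉0
      y⁻¹ = inv y y≉0

      x⁻¹≈βy⁻¹ : x⁻¹ ≈ ι β * y⁻¹
      x⁻¹≈βy⁻¹ = begin
        x⁻¹                      ≈⟨ *-identityʳ _ ⟨
        x⁻¹ * 1#                 ≈⟨ *-congˡ (trans (*-comm _ _) (invˡ y y≉0)) ⟨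
        x⁻¹ * (y * y⁻¹)          ≈⟨ *-congˡ (*-congʳ y≈βx) ⟩
        x⁻¹ * (ι β * x * y⁻¹)    ≈⟨ *-congˡ (*-congʳ (*-comm _ _)) ⟩
        x⁻¹ * (x * ι β * y⁻¹)    ≈⟨ *-congˡ (*-assoc _ _ _) ⟩
        x⁻¹ * (x * (ι β * y⁻¹))  ≈⟨ *-assoc _ _ _ ⟨
        x⁻¹ * x * (ι β * y⁻¹)    ≈⟨ *-congʳ (invˡ x x≉0) ⟩
        1# * (ι β * y⁻¹)         ≈⟨ *-identityˡ _ ⟩
        ι β * y⁻¹                ∎

  j[_] : ∀ {p} → Pred Point p → Pred Point (c ⊔ c′ ⊔ ℓ′ ⊔ p)
  j[ X ] P = ∃[ Q ] Q ∈ X × P ≈ₚ Func.to j Q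

  -- F(x), the smallest subfield of L containing F and x.
  data F⟨_⟩ (x : Carrier) : Pred Carrier (c ⊔ c′ ⊔ ℓ′) where
    base      : ∀ α → F⟨ x ⟩ (ι α)
    generator : F⟨ x ⟩ x
    +-closed  : ∀ {y z} → F⟨ x ⟩ y → F⟨ x ⟩ z → F⟨ x ⟩ (y + z)
    neg-closed : ∀ {y} → F⟨ x ⟩ y → F⟨ x ⟩ (- y)
    *-closed  : ∀ {y z} → F⟨ x ⟩ y → F⟨ x ⟩ z → F⟨ x ⟩ (y * z)
    inv-closed : ∀ {y} (y≉0 : y ≉ 0#) → F⟨ x ⟩ y → F⟨ x ⟩ (inv y y≉0)
    ≈-closed  : ∀ {y z} → y ≈ z → F⟨ x ⟩ y → F⟨ x ⟩ z

  -- Degree x d states [F(x) : F] = d.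
  Degree : Carrier → ℕ → Set (c ⊔ ℓ ⊔ c′ ⊔ ℓ′)
  Degree x d = HasDimension F⟨ x ⟩ d

{-# OPTIONS --safe #-}
-- Put x = a b⁻¹, of degree m over F with minimal polynomial f.  Up to the factor b, a
-- point of the line is t₀ x − t₁; since (x − T) · (f(x) − f(T)) / (x − T) = − f(T) lies
-- in F at T = t₁ / t₀, its inverse is, up to F, the value at T of (f(x) − f(T)) / (x − T).
-- This polynomial in T has degree m − 1, and its coefficients are monic polynomials in x
-- of distinct degrees below m, hence linearly independent over F.
module Submission where

open import Defs
open import Algebra.Bundles using (CommutativeSemiring; Ring; Semiring)
open import Algebra.Module.Bundles using (LeftModule)
open import Algebra.Morphism.Structures using (IsRingMonomorphism)
import Algebra.Properties.CommutativeMonoid.Sum as SumProperties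
import Algebra.Properties.Group as GroupProperties
import Algebra.Definitions.RawSemiring as RawSemiringDefinitions
import Algebra.Properties.Ring as RingProperties
import Algebra.Solver.Ring.NaturalCoefficients.Default as SemiringSolver
open import Algebra.Module.Morphism.Structures using (IsLeftModuleMonomorphism)
open import Data.Sum.Base using (_⊎_; inj₁; inj₂)
open import Data.Fin.Base using (Fin; zero; suc; toℕ; combine; fromℕ; finToFun; funToFin)
open import Data.Fin.Properties using (any?; injective⇒≤;
  finToFun-funToFin; funToFin-finToFin)
import Data.Fin.Properties as Fin
open import Data.Nat.Base using (ℕ; zero; suc; _≤_; _<_; _^_; _∸_; s≤s; z≤n)
import Data.Nat.Properties as ℕ
open import Data.Product.Base using (∃-syntax; _×_; _,_; proj₁; proj₂)
open import Data.Vec.Functional using (Vector; _∷_; []; tail)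
open import Function.Base using (case_of_)
open import Function.Bundles using (Func; Inverse; Equivalence; mk⇔)
open import Function.Definitions using (Injective)
open import Relation.Binary.PropositionalEquality.Core using (_≡_; cong; cong₂)
import Relation.Binary.PropositionalEquality.Core as ≡
import Relation.Binary.Reasoning.Setoid as SetoidReasoning
open import Relation.Nullary using (¬_; Dec; yes; no; contradiction)
open import Relation.Nullary.Decidable using (map′)
open import Relation.Unary using (Pred; _∈_; _∉_; _⊆_; _≐_)

-- Counting on finite sets.

-- Pigeonhole: if `y` were missed, `f` together with `y` as an extra value would inject
-- `Fin (suc n)` into `Fin n`.
injective⇒hits : ∀ {n} {f : Fin n → Fin n} → Injective _≡_ _≡_ f → ∀ y → ∃[ i ] f i ≡ y
injective⇒hits {n} {f} f-inj y with any? (λ i → f i Fin.≟ y)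
... | yes hit = hit
... | no miss = contradiction (injective⇒≤ g-inj) ℕ.1+n≰n
  where
  g : Fin (suc n) → Fin n
  g zero    = y
  g (suc i) = f i

  g-inj : Injective _≡_ _≡_ g
  g-inj {zero}  {zero}  _  = ≡.refl
  g-inj {zero}  {suc j} eq = contradiction (j , ≡.sym eq) miss
  g-inj {suc i} {zero}  eq = contradiction (i , eq) miss
  g-inj {suc i} {suc j} eq = cong suc (f-inj eq)

funToFin-cong : ∀ {m n} {f g : Fin m → Fin n} → (∀ i → f i ≡ g i) → funToFin f ≡ funToFin g
funToFin-cong {zero}  eq = ≡.refl
funToFin-cong {suc m} eq = cong₂ combine (eq zero) (funToFin-cong (λ i → eq (suc i)))

-- Subtraction-free identities behind the Horner-form inductions.

module SemiringIdentities {c ℓ} (R : CommutativeSemiring c ℓ) where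
  open CommutativeSemiring R
  open SemiringSolver R using (solve; con; _:+_; _:*_; _:=_)

  horner-+ : ∀ x a b p q → (a + b) + x * (p + q) ≈ (a + x * p) + (b + x * q)
  horner-+ = solve 5 (λ x a b p q → (a :+ b) :+ x :* (p :+ q) := (a :+ x :* p) :+ (b :+ x :* q)) refl

  horner-* : ∀ x k a p → k * a + x * (k * p) ≈ k * (a + x * p)
  horner-* = solve 4 (λ x k a p → k :* a :+ x :* (k :* p) := k :* (a :+ x :* p)) refl

  horner-leading : ∀ x a z k p → a + x * (z + k * p) ≈ (a + x * z) + k * (x * p)
  horner-leading =
    solve 5 (λ x a z k p → a :+ x :* (z :+ k :* p) := (a :+ x :* z) :+ k :* (x :* p)) refl

  horner-monic : ∀ x b p q → b + x * (p + q) ≈ x * p + (b + x * q)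
  horner-monic = solve 4 (λ x b p q → b :+ x :* (p :+ q) := x :* p :+ (b :+ x :* q)) refl

  factor-out : ∀ g y v s → g * (y * v) + y * s ≈ y * (g * v + s)
  factor-out = solve 4 (λ g y v s → g :* (y :* v) :+ y :* s := y :* (g :* v :+ s)) refl

  quotients-base : ∀ x s t b → s * x * 1# + (t + s * b) ≈ t * 1# + s * (b + x * 1#)
  quotients-base =
    solve 4 (λ x s t b → s :* x :* con 1 :+ (t :+ s :* b) := t :* con 1 :+ s :* (b :+ x :* con 1)) refl

  quotients-step : ∀ x s t p M S h b →
    s * x * (p * M + t * S) + (t * h + s * p * b) ≈ t * (s * x * S + h) + s * p * (b + x * M)
  quotients-step = solve 8 (λ x s t p M S h b →
    s :* x :* (p :* M :+ t :* S) :+ (t :* h :+ s :* p :* b)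
    := t :* (s :* x :* S :+ h) :+ s :* p :* (b :+ x :* M)) refl

-- Counting and decidability for vectors over a finite field.

module FiniteFieldProperties {c ℓ ℓ# q} (F : FiniteField c ℓ ℓ# q) where
  open FiniteField F hiding (zero)
  open Inverse enumeration using (to; from; to-cong; strictlyInverseˡ; strictlyInverseʳ)

  infix 4 _≋_
  _≋_ : ∀ {k} → Vector Carrier k → Vector Carrier k → Set ℓ
  u ≋ v = ∀ i → u i ≈ v i

  encode : ∀ {k} → Vector Carrier k → Fin (q ^ k)
  encode u = funToFin (λ i → to (u i))

  decode : ∀ k → Fin (q ^ k) → Vector Carrier k
  decode k i j = from (finToFun i j)

  decode-encode : ∀ {k} (u : Vector Carrier k) → decode k (encode u) ≋ u
  decode-encode u j =
    trans (reflexive (cong from (finToFun-funToFin (λ i → to (u i)) j))) (strictlyInverseʳ (u j))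

  encode-decode : ∀ k i → encode (decode k i) ≡ i
  encode-decode k i =
    ≡.trans (funToFin-cong {k} (λ j → strictlyInverseˡ (finToFun {q} {k} i j))) (funToFin-finToFin {k} i)

  encode-cong : ∀ {k} {u v : Vector Carrier k} → u ≋ v → encode u ≡ encode v
  encode-cong u≋v = funToFin-cong (λ i → to-cong (u≋v i))

  encode-injective : ∀ {k} {u v : Vector Carrier k} → encode u ≡ encode v → u ≋ v
  encode-injective {k} {u} {v} eq i =
    trans (sym (decode-encode u i))
      (trans (reflexive (cong (λ e → decode k e i) eq)) (decode-encode v i))

  decode-injective : ∀ {k i j} → decode k i ≋ decode k j → i ≡ j
  decode-injective {k} {i} {j} eq =
    ≡.trans (≡.sym (encode-decode k i)) (≡.trans (encode-cong eq) (encode-decode k j))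

  module _ {k l} {f : Vector Carrier k → Vector Carrier l} (f-inj : Injective _≋_ _≋_ f) where
    private
      f′ : Fin (q ^ k) → Fin (q ^ l)
      f′ i = encode (f (decode k i))

      f′-injective : Injective _≡_ _≡_ f′
      f′-injective eq = decode-injective (f-inj (encode-injective eq))

    -- Numbering the vectors turns `f` into an injection from `q ^ k` to `q ^ l` elements; as 0 and
    -- 1 are distinct, `1 < q`, so the exponents compare.
    injection⇒≤ : k ≤ l
    injection⇒≤ = ℕ.≮⇒≥ λ l<k →
      ℕ.≤⇒≯ (injective⇒≤ {f = f′} f′-injective) (ℕ.^-monoʳ-< q 1<q l<k)
      where
      [0,1] : Fin 2 → Fin q
      [0,1] zero       = to 0#
      [0,1] (suc zero) = to 1#

      to-injective : ∀ {x y} → to x ≡ to y → x ≈ y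
      to-injective {x} {y} eq =
        trans (sym (strictlyInverseʳ x)) (trans (reflexive (cong from eq)) (strictlyInverseʳ y))

      [0,1]-injective : Injective _≡_ _≡_ [0,1]
      [0,1]-injective {zero}     {zero}     _  = ≡.refl
      [0,1]-injective {zero}     {suc zero} eq = contradiction (sym (to-injective eq)) 1≉0
      [0,1]-injective {suc zero} {zero}     eq = contradiction (to-injective eq) 1≉0
      [0,1]-injective {suc zero} {suc zero} _  = ≡.refl

      1<q : 1 < q
      1<q = injective⇒≤ [0,1]-injective

  injection⇒hits : ∀ {k} {f : Vector Carrier k → Vector Carrier k} → Injective _≋_ _≋_ f →
                   ∀ v → ∃[ u ] f u ≋ v
  injection⇒hits {k} {f} f-inj v
    with i , eq ← injective⇒hits {f = λ i → encode (f (decode k i))}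
                    (λ eq → decode-injective (f-inj (encode-injective eq))) (encode v)
    = decode k i , encode-injective eq

  -- The search runs over the finitely many decoded vectors; each vector agrees pointwise with one
  -- of them, and `resp` transports the witness.
  anyVector? : ∀ {p k} {P : Pred (Vector Carrier k) p} → (∀ {u v} → u ≋ v → P u → P v) →
               (∀ u → Dec (P u)) → Dec (∃[ u ] P u)
  anyVector? {k = k} resp P? =
    map′ (λ (i , p) → decode k i , p)
         (λ (u , p) → encode u , resp (λ i → sym (decode-encode u i)) p)
         (any? (λ i → P? (decode k i)))

  noZeroDivisors : ∀ {x y} → x * y ≈ 0# → x ≉ 0# → y ≈ 0#
  noZeroDivisors {x} {y} xy≈0 x≉0 = begin
    y                    ≈⟨ *-identityˡ y ⟨
    1# * y               ≈⟨ *-congʳ (invˡ x x≉0) ⟨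
    inv x x≉0 * x * y    ≈⟨ *-assoc _ _ _ ⟩
    inv x x≉0 * (x * y)  ≈⟨ *-congˡ xy≈0 ⟩
    inv x x≉0 * 0#       ≈⟨ zeroʳ _ ⟩
    0#                   ∎
    where open SetoidReasoning setoid

  -x≈0⇒x≈0 : ∀ {x} → - x ≈ 0# → x ≈ 0#
  -x≈0⇒x≈0 -x≈0 = GroupProperties.⁻¹-injective +-group
    (trans -x≈0 (sym (GroupProperties.ε⁻¹≈ε +-group)))

-- Independence, dimension by counting, and the points and lines of PG(V).

module LinearAlgebra {c ℓ ℓ# m ℓm q} (F : FiniteField c ℓ ℓ# q)
                     (V : LeftModule (FiniteField.ring F) m ℓm) where
  private
    module F = FiniteField F
  open FiniteFieldProperties F
  open LeftModule V
  open ProjectiveSpace F V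
  open SumProperties +ᴹ-commutativeMonoid using (sum-cong-≋; ∑-distrib-+)
  open SetoidReasoning ≈ᴹ-setoid

  Independent : ∀ {k} → Vector Carrierᴹ k → Set _
  Independent v = ∀ α → linearCombination α v ≈ᴹ 0ᴹ → ∀ i → α i F.≈ F.0#

  Span : ∀ {k} → Vector Carrierᴹ k → Pred Carrierᴹ _
  Span v x = ∃[ α ] x ≈ᴹ linearCombination α v

  module _ {k} (v : Vector Carrierᴹ k) where
    linearCombination-cong : ∀ {α β} → α ≋ β → linearCombination α v ≈ᴹ linearCombination β v
    linearCombination-cong eq = sum-cong-≋ (λ i → *ₗ-congʳ (eq i))

    linearCombination-+ : ∀ α β → linearCombination (λ i → α i F.+ β i) v
                                  ≈ᴹ linearCombination α v +ᴹ linearCombination β v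
    linearCombination-+ α β =
      ≈ᴹ-trans (sum-cong-≋ (λ i → *ₗ-distribʳ (v i) (α i) (β i))) (∑-distrib-+ (λ i → α i *ₗ v i) (λ i → β i *ₗ v i))

  linearCombination-* : ∀ {k} (v : Vector Carrierᴹ k) κ α →
                        linearCombination (λ i → κ F.* α i) v ≈ᴹ κ *ₗ linearCombination α v
  linearCombination-* {zero}  v κ α = ≈ᴹ-sym (*ₗ-zeroʳ κ)
  linearCombination-* {suc k} v κ α =
    ≈ᴹ-trans (+ᴹ-cong (*ₗ-assoc κ (α zero) (v zero)) (linearCombination-* (tail v) κ (tail α)))
             (≈ᴹ-sym (*ₗ-distribˡ κ _ _))

  linearCombination-0 : ∀ {k} (v : Vector Carrierᴹ k) → linearCombination (λ _ → F.0#) v ≈ᴹ 0ᴹ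
  linearCombination-0 {zero}  v = ≈ᴹ-refl
  linearCombination-0 {suc k} v =
    ≈ᴹ-trans (+ᴹ-cong (*ₗ-zeroˡ (v zero)) (linearCombination-0 (tail v))) (+ᴹ-identityˡ 0ᴹ)

  linearCombination-injective : ∀ {k} {v : Vector Carrierᴹ k} → Independent v → ∀ {α β} →
    linearCombination α v ≈ᴹ linearCombination β v → α ≋ β
  linearCombination-injective {v = v} indep {α} {β} eq i =
    GroupProperties.x∙y⁻¹≈ε⇒x≈y F.+-group (α i) (β i) (indep δ δ≈0 i)
    where
    δ = λ i → α i F.+ F.- β i

    δ≈0 : linearCombination δ v ≈ᴹ 0ᴹ
    δ≈0 = GroupProperties.identityˡ-unique +ᴹ-group _ (linearCombination β v) (begin
      linearCombination δ v +ᴹ linearCombination β v  ≈⟨ linearCombination-+ v δ β ⟨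
      linearCombination (λ i → δ i F.+ β i) v         ≈⟨ linearCombination-cong v (λ i →
        F.trans (F.+-assoc (α i) (F.- β i) (β i)) (F.trans (F.+-congˡ (F.-‿inverseˡ (β i))) (F.+-identityʳ (α i)))) ⟩
      linearCombination α v                           ≈⟨ eq ⟩
      linearCombination β v                           ∎)

  private
    *ₗ-inv : ∀ {κ} (κ≉0 : κ F.≉ F.0#) x → F.inv κ κ≉0 *ₗ (κ *ₗ x) ≈ᴹ x
    *ₗ-inv {κ} κ≉0 x =
      ≈ᴹ-trans (≈ᴹ-sym (*ₗ-assoc (F.inv κ κ≉0) κ x)) (≈ᴹ-trans (*ₗ-congʳ (F.invˡ κ κ≉0)) (*ₗ-identityˡ x))

  -- A nonzero coefficient at `w` in a relation could be divided out, which would put `w` into the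
  -- span of `v`.
  independent-∷ : ∀ {k} {w} {v : Vector Carrierᴹ k} → Independent v → w ∉ Span v → Independent (w ∷ v)
  independent-∷ {w = w} {v} indep w∉ α eq = λ where
      zero    → -x≈0⇒x≈0 -α₀≈0
      (suc i) → indep (tail α) (≈ᴹ-trans tail≈ (≈ᴹ-trans (*ₗ-congʳ -α₀≈0) (*ₗ-zeroˡ w))) i
    where
    -α₀ = F.- α zero

    tail≈ : linearCombination (tail α) v ≈ᴹ -α₀ *ₗ w
    tail≈ = ≈ᴹ-trans (uniqueʳ‿-ᴹ (α zero *ₗ w) _ eq) (≈ᴹ-sym (uniqueʳ‿-ᴹ (α zero *ₗ w) _ (begin
      α zero *ₗ w +ᴹ -α₀ *ₗ w  ≈⟨ *ₗ-distribʳ w (α zero) -α₀ ⟨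
      (α zero F.+ -α₀) *ₗ w    ≈⟨ *ₗ-congʳ (F.-‿inverseʳ (α zero)) ⟩
      F.0# *ₗ w                ≈⟨ *ₗ-zeroˡ w ⟩
      0ᴹ                       ∎)))

    -α₀≈0 : -α₀ F.≈ F.0#
    -α₀≈0 with -α₀ F.≟ F.0#
    ... | yes eq₀ = eq₀
    ... | no -α₀≉0 = contradiction (_ , (begin
      w                                                             ≈⟨ *ₗ-inv -α₀≉0 w ⟨
      F.inv -α₀ -α₀≉0 *ₗ (-α₀ *ₗ w)                                  ≈⟨ *ₗ-congˡ tail≈ ⟨
      F.inv -α₀ -α₀≉0 *ₗ linearCombination (tail α) v                ≈⟨ linearCombination-* v _ (tail α) ⟨
      linearCombination (λ i → F.inv -α₀ -α₀≉0 F.* tail α i) v       ∎)) w∉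

  -- Dimension comparisons by counting: F^k cannot be injected into F^l for l < k,
  -- and an injection F^k → F^k is onto.  The parametrisation ρ need not be linear.
  module _ {k l} {u : Vector Carrierᴹ k} (indep : Independent u)
           {ρ : Vector F.Carrier l → Carrierᴹ} (ρ-cong : ∀ {α β} → α ≋ β → ρ α ≈ᴹ ρ β)
           (covers : ∀ α → ∃[ β ] linearCombination α u ≈ᴹ ρ β) where

    private
      coordinates : Vector F.Carrier k → Vector F.Carrier l
      coordinates α = proj₁ (covers α)

      coordinates-injective : Injective _≋_ _≋_ coordinates
      coordinates-injective {α} {β} eq = linearCombination-injective indep
        (≈ᴹ-trans (proj₂ (covers α)) (≈ᴹ-trans (ρ-cong eq) (≈ᴹ-sym (proj₂ (covers β)))))

    independent⇒≤ : k ≤ l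
    independent⇒≤ = injection⇒≤ coordinates-injective

    independent⇒spanning : k ≡ l → ∀ β → ρ β ∈ Span u
    independent⇒spanning ≡.refl β with α , eq ← injection⇒hits coordinates-injective β =
      α , ≈ᴹ-trans (ρ-cong (λ i → F.sym (eq i))) (≈ᴹ-sym (proj₂ (covers α)))

  -- The scalar `κ` is nonzero because `y` is, so dividing by it gives the reverse inclusion.
  ∈⟨⟩⇒≐ : ∀ {x y} → y ≉ᴹ 0ᴹ → y ∈ ⟨ x ⟩ → ⟨ y ⟩ ≐ ⟨ x ⟩
  ∈⟨⟩⇒≐ {x} {y} y≉0 (κ , y≈κx) = y⊆x , x⊆y
    where
    κ≉0 : κ F.≉ F.0#
    κ≉0 κ≈0 = y≉0 (≈ᴹ-trans y≈κx (≈ᴹ-trans (*ₗ-congʳ κ≈0) (*ₗ-zeroˡ x)))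

    y⊆x : ⟨ y ⟩ ⊆ ⟨ x ⟩
    y⊆x (α , z≈αy) = α F.* κ , ≈ᴹ-trans z≈αy (≈ᴹ-trans (*ₗ-congˡ y≈κx) (≈ᴹ-sym (*ₗ-assoc α κ x)))

    x⊆y : ⟨ x ⟩ ⊆ ⟨ y ⟩
    x⊆y {z} (α , z≈αx) = α F.* F.inv κ κ≉0 , (begin
      z                              ≈⟨ z≈αx ⟩
      α *ₗ x                         ≈⟨ *ₗ-congˡ (*ₗ-inv κ≉0 x) ⟨
      α *ₗ (F.inv κ κ≉0 *ₗ (κ *ₗ x))  ≈⟨ *ₗ-congˡ (*ₗ-congˡ y≈κx) ⟨
      α *ₗ (F.inv κ κ≉0 *ₗ y)         ≈⟨ *ₗ-assoc α _ y ⟨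
      (α F.* F.inv κ κ≉0) *ₗ y        ∎)

  distinct⇒independent : ∀ P Q → P ≉ₚ Q → Independent (vector P ∷ vector Q ∷ [])
  distinct⇒independent P Q P≉Q =
    independent-∷ {w = vector P} {vector Q ∷ []} (independent-∷ {w = vector Q} {[]} (λ _ _ ()) λ (_ , Q≈0) → nonzero Q Q≈0)
      λ (α , P≈) → P≉Q (∈⟨⟩⇒≐ (nonzero P) (α zero , ≈ᴹ-trans P≈ (+ᴹ-identityʳ _)))

  -- The span of two distinct points of the line lies in its subspace; both have dimension 2, so
  -- counting makes them equal.
  line≐Span : ∀ {p} (line : Line p) P Q → P ≉ₚ Q → P ∈ pointsOf line → Q ∈ pointsOf line →
              Line.subspace line ≐ Span (vector P ∷ vector Q ∷ [])
  line≐Span line P Q P≉Q P∈ Q∈ = W⊆Span , Span⊆W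
    where
    open Line line renaming (subspace to W)
    v = proj₁ dimension-2
    open IsBasis (proj₂ dimension-2)

    combination∈Span : ∀ γ → linearCombination γ (vector P ∷ vector Q ∷ []) ∈ Span v
    combination∈Span γ =
      let α , P≈ = Equivalence.to (spans _) (P∈ (γ zero , ≈ᴹ-refl))
          β , Q≈ = Equivalence.to (spans _) (Q∈ (γ (suc zero) , ≈ᴹ-refl))
      in (λ i → α i F.+ β i) , (begin
        γ zero *ₗ vector P +ᴹ (γ (suc zero) *ₗ vector Q +ᴹ 0ᴹ)  ≈⟨ +ᴹ-congˡ (+ᴹ-identityʳ _) ⟩
        γ zero *ₗ vector P +ᴹ γ (suc zero) *ₗ vector Q         ≈⟨ +ᴹ-cong P≈ Q≈ ⟩
        linearCombination α v +ᴹ linearCombination β v         ≈⟨ linearCombination-+ v α β ⟨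
        linearCombination (λ i → α i F.+ β i) v                ∎)

    W⊆Span : W ⊆ Span (vector P ∷ vector Q ∷ [])
    W⊆Span x∈W =
      let ω , x≈ = Equivalence.to (spans _) x∈W
          -- The parametrisation here is by coordinates in the basis `v` of the line, so both sides
          -- are counted by F².
          γ , eq = independent⇒spanning {u = vector P ∷ vector Q ∷ []} (distinct⇒independent P Q P≉Q)
                     (linearCombination-cong v) combination∈Span ≡.refl ω
      in γ , ≈ᴹ-trans x≈ eq

    Span⊆W : Span (vector P ∷ vector Q ∷ []) ⊆ W
    Span⊆W (γ , x≈) =
      let α , eq = combination∈Span γ in Equivalence.from (spans _) (α , ≈ᴹ-trans x≈ eq)

  -- Supplies the injective linear map φ of the uple embedding.
  combinations-mono : ∀ {k} {v : Vector Carrierᴹ k} → Independent v →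
    IsLeftModuleMonomorphism (F^ k) rawLeftModule (λ α → linearCombination α v)
  combinations-mono {v = v} indep = record
    { isLeftModuleHomomorphism = record
      { +ᴹ-isGroupHomomorphism = record
        { isMonoidHomomorphism = record
          { isMagmaHomomorphism = record
            { isRelHomomorphism = record { cong = linearCombination-cong v }
            ; homo = linearCombination-+ v
            }
          ; ε-homo = linearCombination-0 v
          }
        ; ⁻¹-homo = λ α → uniqueʳ‿-ᴹ _ _ (begin
            linearCombination α v +ᴹ linearCombination (λ i → F.- α i) v  ≈⟨ linearCombination-+ v α _ ⟨
            linearCombination (λ i → α i F.+ F.- α i) v
              ≈⟨ linearCombination-cong v (λ i → F.-‿inverseʳ (α i)) ⟩
            linearCombination (λ _ → F.0#) v                             ≈⟨ linearCombination-0 v ⟩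
            0ᴹ                                                           ∎)
        }
      ; *ₗ-homo = linearCombination-* v
      }
    ; injective = linearCombination-injective indep
    }

  open RawSemiringDefinitions (Semiring.rawSemiring F.semiring) using () renaming (_^_ to _^ꟳ_)

  ^≈0⇒≈0 : ∀ k {t} → t ^ꟳ k F.≈ F.0# → t F.≈ F.0#
  ^≈0⇒≈0 zero    1≈0 = contradiction 1≈0 F.1≉0
  ^≈0⇒≈0 (suc k) {t} tᵏ⁺¹≈0 with t F.≟ F.0#
  ... | yes t≈0 = t≈0
  ... | no  t≉0 = ^≈0⇒≈0 k (noZeroDivisors tᵏ⁺¹≈0 t≉0)

  -- The first and last entries are t₀ʳ and t₁ʳ, and a field has no nonzero nilpotents. Hence
  -- nonzero parameters give a nonzero vector of monomials.
  monomials≈0 : ∀ r {t₀ t₁} → monomials r t₀ t₁ ≋ (λ _ → F.0#) → t₀ F.≈ F.0# × t₁ F.≈ F.0#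
  monomials≈0 r {t₀} {t₁} eq =
    ^≈0⇒≈0 r (F.trans (F.sym (F.*-identityʳ _)) (eq zero)) ,
    ^≈0⇒≈0 r (F.trans (F.sym (F.trans (F.reflexive last≡) (F.*-identityˡ _))) (eq (fromℕ r)))
    where
    last≡ : monomials r t₀ t₁ (fromℕ r) ≡ (t₀ ^ꟳ 0) F.* (t₁ ^ꟳ r)
    last≡ = cong₂ (λ i j → (t₀ ^ꟳ i) F.* (t₁ ^ꟳ j))
      (≡.trans (cong (r ∸_) (Fin.toℕ-fromℕ r)) (ℕ.n∸n≡0 r)) (Fin.toℕ-fromℕ r)

-- Polynomials in a fixed element `x` of L with coefficients in F.

module SimpleExtension {c ℓ ℓ# c′ ℓ′ ℓ#′ q q′}
  (F : FiniteField c ℓ ℓ# q) (L : FiniteField c′ ℓ′ ℓ#′ q′)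
  (ι : FiniteField.Carrier F → FiniteField.Carrier L)
  (ι-mono : IsRingMonomorphism (Ring.rawRing (FiniteField.ring F)) (Ring.rawRing (FiniteField.ring L)) ι)
  (x : FiniteField.Carrier L) where

  private
    module F = FiniteField F
    module ι = IsRingMonomorphism ι-mono
  open FiniteField L hiding (zero)
  open FiniteFieldProperties F using (_≋_; anyVector?)
  open FiniteFieldProperties L using (noZeroDivisors)
  open Extension F L ι ι-mono
  open LinearAlgebra F asVectorSpace
  open RawSemiringDefinitions (Semiring.rawSemiring semiring) using () renaming (_^_ to _^ᴸ_)
  open RawSemiringDefinitions (Semiring.rawSemiring F.semiring) using () renaming (_^_ to _^ꟳ_)
  open SemiringIdentities commutativeSemiring
  open SetoidReasoning setoid

  -- Coefficients are listed from the constant term upwards, and evaluation at `x` is in Horner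
  -- form.
  poly : ∀ {k} → Vector F.Carrier k → Carrier
  poly {zero}  α = 0#
  poly {suc k} α = ι (α zero) + x * poly (tail α)

  poly-cong : ∀ {k} {α β : Vector F.Carrier k} → α ≋ β → poly α ≈ poly β
  poly-cong {zero}  eq = refl
  poly-cong {suc k} eq = +-cong (ι.⟦⟧-cong (eq zero)) (*-congˡ (poly-cong (λ i → eq (suc i))))

  poly-+ : ∀ {k} (α β : Vector F.Carrier k) → poly (λ i → α i F.+ β i) ≈ poly α + poly β
  poly-+ {zero}  α β = sym (+-identityˡ 0#)
  poly-+ {suc k} α β = trans (+-cong (ι.+-homo _ _) (*-congˡ (poly-+ (tail α) (tail β))))
    (horner-+ x _ _ _ _)

  poly-* : ∀ {k} κ (α : Vector F.Carrier k) → poly (λ i → κ F.* α i) ≈ ι κ * poly α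
  poly-* {zero}  κ α = sym (zeroʳ (ι κ))
  poly-* {suc k} κ α = trans (+-cong (ι.*-homo _ _) (*-congˡ (poly-* κ (tail α))))
    (horner-* x (ι κ) _ _)

  Poly : ℕ → Pred Carrier _
  Poly k z = ∃[ α ] z ≈ poly {k} α

  Poly-≈ : ∀ {k y z} → y ≈ z → z ∈ Poly k → y ∈ Poly k
  Poly-≈ y≈z (α , z≈) = α , trans y≈z z≈

  Poly-+ : ∀ {k y z} → y ∈ Poly k → z ∈ Poly k → y + z ∈ Poly k
  Poly-+ (α , y≈) (β , z≈) = _ , trans (+-cong y≈ z≈) (sym (poly-+ α β))

  Poly-* : ∀ {k z} κ → z ∈ Poly k → ι κ * z ∈ Poly k
  Poly-* κ (α , z≈) = _ , trans (*-congˡ z≈) (sym (poly-* κ α))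

  Poly-0 : ∀ {k} → 0# ∈ Poly k
  Poly-0 {zero}  = [] , refl
  Poly-0 {suc k} with α , 0≈ ← Poly-0 {k} =
    F.0# ∷ α , sym (trans (+-cong ι.0#-homo (trans (*-congˡ (sym 0≈)) (zeroʳ x))) (+-identityˡ 0#))

  Poly-- : ∀ {k z} → z ∈ Poly k → - z ∈ Poly k
  Poly-- {z = z} z∈ = Poly-≈ -z≈ (Poly-* (F.- F.1#) z∈)
    where
    -z≈ : - z ≈ ι (F.- F.1#) * z
    -z≈ = trans (sym (RingProperties.-1*x≈-x ring z))
            (*-congʳ (trans (-‿cong (sym ι.1#-homo)) (sym (ι.-‿homo F.1#))))

  Poly-∷ : ∀ {k z} α → z ∈ Poly k → ι α + x * z ∈ Poly (suc k)
  Poly-∷ α (β , z≈) = α ∷ β , +-congˡ (*-congˡ z≈)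

  Poly-suc : ∀ {k} → Poly k ⊆ Poly (suc k)
  Poly-suc {zero}  (α , z≈) = Poly-≈ z≈ Poly-0
  Poly-suc {suc k} (α , z≈) = Poly-≈ z≈ (Poly-∷ (α zero) (Poly-suc (tail α , refl)))

  -- Horner form exposes the constant term; this exposes the top term instead, so that a relation
  -- for `x ^ᴸ k` can be substituted.
  poly-leading : ∀ k (α : Vector F.Carrier (suc k)) →
                 ∃[ z ] ∃[ κ ] z ∈ Poly k × poly α ≈ z + ι κ * x ^ᴸ k
  poly-leading zero α = 0# , α zero , Poly-0 ,
    trans (trans (+-congˡ (zeroʳ x)) (+-comm _ 0#)) (+-congˡ (sym (*-identityʳ _)))
  poly-leading (suc k) α with z , κ , z∈ , eq ← poly-leading k (tail α) =
    ι (α zero) + x * z , κ , Poly-∷ (α zero) z∈ , trans (+-congˡ (*-congˡ eq))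
      (horner-leading x _ z _ _)

  Poly? : ∀ k z → Dec (z ∈ Poly k)
  Poly? k z = anyVector? (λ eq z≈ → trans z≈ (poly-cong eq)) (λ α → z ≟ poly α)

  -- Monic polynomials in `x` and the coefficients of the difference quotient.

  monic : ∀ {k} → Vector F.Carrier k → Carrier
  monic {zero}  β = 1#
  monic {suc k} β = ι (β zero) + x * monic (tail β)

  monic≈ : ∀ {k} (β : Vector F.Carrier k) → monic β ≈ x ^ᴸ k + poly β
  monic≈ {zero}  β = sym (+-identityʳ 1#)
  monic≈ {suc k} β = trans (+-congˡ (*-congˡ (monic≈ (tail β))))
    (horner-monic x _ _ _)

  monic∈Poly : ∀ {k} (β : Vector F.Carrier k) → monic β ∈ Poly (suc k)
  monic∈Poly {zero}  β = Poly-≈ 1≈ (Poly-∷ F.1# Poly-0)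
    where
    1≈ : 1# ≈ ι F.1# + x * 0#
    1≈ = sym (trans (+-cong ι.1#-homo (zeroʳ x)) (+-identityʳ 1#))
  monic∈Poly {suc k} β = Poly-∷ (β zero) (monic∈Poly (tail β))

  -- The coefficients, as polynomials in T, of (f(x) − f(T)) / (x − T), where f is the
  -- monic polynomial with lower coefficients β.
  quotients : ∀ {k} → Vector F.Carrier k → Vector Carrier k
  quotients {zero}  β = []
  quotients {suc k} β = monic (tail β) ∷ quotients (tail β)

  -- The entries of `quotients β` are values of monic polynomials of degrees `k` - 1 down to 0.
  Span-quotients⊆Poly : ∀ {k} (β : Vector F.Carrier k) γ → linearCombination γ (quotients β) ∈ Poly k
  Span-quotients⊆Poly {zero}  β γ = Poly-0
  Span-quotients⊆Poly {suc k} β γ =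
    Poly-+ (Poly-* (γ zero) (monic∈Poly (tail β))) (Poly-suc (Span-quotients⊆Poly (tail β) (tail γ)))

  -- Equivalently, no monic polynomial over F of degree below `k` vanishes at `x`.
  NoRelationBelow : ℕ → Set _
  NoRelationBelow k = ∀ j → j < k → x ^ᴸ j ∉ Poly j

  -- The head is monic of degree `k`, while the tail spans only polynomials of lower degree. If the
  -- head were in that span, `x ^ᴸ k` would be a polynomial in `x` of degree below `k`.
  quotients-independent : ∀ {k} (β : Vector F.Carrier k) → NoRelationBelow k → Independent (quotients β)
  quotients-independent {zero}  β free = λ _ _ ()
  quotients-independent {suc k} β free =
    independent-∷ (quotients-independent (tail β) (λ j j<k → free j (ℕ.m≤n⇒m≤1+n j<k)))
      λ (γ , eq) → free k ℕ.≤-refl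
        (Poly-≈ xᵏ≈ (Poly-+ (Poly-≈ eq (Span-quotients⊆Poly (tail β) γ)) (Poly-- (tail β , refl))))
    where
    xᵏ≈ : x ^ᴸ k ≈ monic (tail β) + - poly (tail β)
    xᵏ≈ = begin
      x ^ᴸ k                                           ≈⟨ +-identityʳ _ ⟨
      x ^ᴸ k + 0#                                      ≈⟨ +-congˡ (-‿inverseʳ _) ⟨
      x ^ᴸ k + (poly (tail β) + - poly (tail β))       ≈⟨ +-assoc _ _ _ ⟨
      x ^ᴸ k + poly (tail β) + - poly (tail β)         ≈⟨ +-congʳ (monic≈ (tail β)) ⟨
      monic (tail β) + - poly (tail β)                 ∎

  -- The degree of the minimal polynomial of `x`, and F(x) as the polynomials in `x` below that
  -- degree.

  IsDegree : ℕ → Set _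
  IsDegree d = x ^ᴸ d ∈ Poly d × NoRelationBelow d

  -- Exponents are tested upwards, so the first relation found has least degree.
  findDegree : ∀ k → NoRelationBelow k ⊎ ∃[ d ] IsDegree d
  findDegree zero = inj₁ λ _ ()
  findDegree (suc k) with findDegree k
  ... | inj₂ found = inj₂ found
  ... | inj₁ free with Poly? k (x ^ᴸ k)
  ...   | yes rel = inj₂ (k , rel , free)
  ...   | no ¬rel = inj₁ λ j j<1+k → case ℕ.m<1+n⇒m<n∨m≡n j<1+k of λ where
      (inj₁ j<k)    → free j j<k
      (inj₂ ≡.refl) → ¬rel

  linearCombination-scale : ∀ {k} y (v : Vector Carrier k) γ →
    linearCombination γ (λ i → y * v i) ≈ y * linearCombination γ v
  linearCombination-scale {zero}  y v γ = sym (zeroʳ y)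
  linearCombination-scale {suc k} y v γ = trans (+-congˡ (linearCombination-scale y (tail v) (tail γ)))
    (factor-out _ y _ _)

  independent-scale : ∀ {k y} {v : Vector Carrier k} → y ≉ 0# → Independent v →
                      Independent (λ i → y * v i)
  independent-scale {y = y} {v} y≉0 indep γ eq =
    indep γ (noZeroDivisors (trans (sym (linearCombination-scale y v γ)) eq) y≉0)

  Poly-1 : ∀ {k} → x ^ᴸ k ∈ Poly k → 1# ∈ Poly k
  -- At `k = 0` the relation is itself `1# ∈ Poly 0`, which settles the degenerate case.
  Poly-1 {zero}  rel = rel
  Poly-1 {suc k} _   = lift k
    where
    lift : ∀ k → 1# ∈ Poly (suc k)
    lift zero    = monic∈Poly []
    lift (suc k) = Poly-suc (lift k)

  module _ {d} (isDegree : IsDegree d) where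

    private
      relation : x ^ᴸ d ∈ Poly d
      relation = proj₁ isDegree

      v : Vector Carrier d
      -- With zero lower coefficients the quotients are, up to `≈`, the powers of `x` from exponent
      -- `d` - 1 down to 0.
      v = quotients (λ _ → F.0#)

      v-independent : Independent v
      v-independent = quotients-independent _ (proj₂ isDegree)

    -- Multiplying by `x` shifts the coefficients; the one possible term of degree `d` is rewritten
    -- by the relation.
    Poly-x* : ∀ {z} → z ∈ Poly d → x * z ∈ Poly d
    Poly-x* {z} (α , z≈) with y , κ , y∈ , eq ← poly-leading d (F.0# ∷ α) =
      Poly-≈ (begin
        x * z                ≈⟨ *-congˡ z≈ ⟩
        x * poly α           ≈⟨ +-identityˡ _ ⟨
        0# + x * poly α      ≈⟨ +-congʳ ι.0#-homo ⟨
        poly (F.0# ∷ α)      ≈⟨ eq ⟩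
        y + ι κ * x ^ᴸ d     ∎) (Poly-+ y∈ (Poly-* κ relation))

    Poly-*-closed : ∀ {y z} → y ∈ Poly d → z ∈ Poly d → y * z ∈ Poly d
    Poly-*-closed {z = z} (α , y≈) z∈ = Poly-≈ (*-congʳ y≈) (go α)
      where
      go : ∀ {k} (α : Vector F.Carrier k) → poly α * z ∈ Poly d
      go {zero}  α = Poly-≈ (zeroˡ z) Poly-0
      go {suc k} α = Poly-≈
        (trans (distribʳ z _ _) (+-congˡ (*-assoc x _ z)))
        (Poly-+ (Poly-* (α zero) z∈) (Poly-x* (go (tail α))))

    Poly-ι : ∀ α → ι α ∈ Poly d
    Poly-ι α = Poly-≈ (sym (*-identityʳ (ι α))) (Poly-* α (Poly-1 relation))

    -- Multiplication by y is injective on the finite set Poly d, hence hits 1.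
    Poly-inv : ∀ {y} (y≉0 : y ≉ 0#) → y ∈ Poly d → inv y y≉0 ∈ Poly d
    Poly-inv {y} y≉0 y∈ =
      let α , 1≈ = Poly-1 relation
          γ , eq = independent⇒spanning (independent-scale y≉0 v-independent) poly-cong
             (λ γ → Poly-≈ (linearCombination-scale y v γ) (Poly-*-closed y∈ (Span-quotients⊆Poly _ γ)))
             ≡.refl α
      in Poly-≈ (begin
        inv y y≉0                                     ≈⟨ *-identityʳ _ ⟨
        inv y y≉0 * 1#                                ≈⟨ *-congˡ (trans 1≈ eq) ⟩
        inv y y≉0 * linearCombination γ (λ i → y * v i)  ≈⟨ *-congˡ (linearCombination-scale y v γ) ⟩
        inv y y≉0 * (y * linearCombination γ v)       ≈⟨ *-assoc _ _ _ ⟨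
        inv y y≉0 * y * linearCombination γ v         ≈⟨ *-congʳ (invˡ y y≉0) ⟩
        1# * linearCombination γ v                    ≈⟨ *-identityˡ _ ⟩
        linearCombination γ v                         ∎) (Span-quotients⊆Poly _ γ)

    F⟨x⟩⊆Poly : F⟨ x ⟩ ⊆ Poly d
    F⟨x⟩⊆Poly (base α)            = Poly-ι α
    F⟨x⟩⊆Poly generator           = Poly-≈ (sym (*-identityʳ x)) (Poly-x* (Poly-1 relation))
    F⟨x⟩⊆Poly (+-closed y∈ z∈)    = Poly-+ (F⟨x⟩⊆Poly y∈) (F⟨x⟩⊆Poly z∈)
    F⟨x⟩⊆Poly (neg-closed y∈)     = Poly-- (F⟨x⟩⊆Poly y∈)
    F⟨x⟩⊆Poly (*-closed y∈ z∈)    = Poly-*-closed (F⟨x⟩⊆Poly y∈) (F⟨x⟩⊆Poly z∈)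
    F⟨x⟩⊆Poly (inv-closed y≉0 y∈) = Poly-inv y≉0 (F⟨x⟩⊆Poly y∈)
    F⟨x⟩⊆Poly (≈-closed y≈z y∈)   = Poly-≈ (sym y≈z) (F⟨x⟩⊆Poly y∈)

  Poly⊆F⟨x⟩ : ∀ {k} → Poly k ⊆ F⟨ x ⟩
  Poly⊆F⟨x⟩ {zero}  (α , z≈) = ≈-closed (trans ι.0#-homo (sym z≈)) (base F.0#)
  Poly⊆F⟨x⟩ {suc k} (α , z≈) =
    ≈-closed (sym z≈) (+-closed (base (α zero)) (*-closed generator (Poly⊆F⟨x⟩ (tail α , refl))))

  -- A basis of F(x) has `m` elements. Powers of `x` without a relation are independent in F(x),
  -- which bounds `d` by `m`; and F(x) lies in `Poly d`, which bounds `m` by `d`.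
  degree⇒isDegree : ∀ {m} → Degree x m → IsDegree m
  degree⇒isDegree {m} (v , basis) = result
    where
    open IsBasis basis

    free⇒≤m : ∀ {k} → NoRelationBelow k → k ≤ m
    free⇒≤m free = independent⇒≤ (quotients-independent (λ _ → F.0#) free)
      (linearCombination-cong v)
      λ γ → Equivalence.to (spans _) (Poly⊆F⟨x⟩ (Span-quotients⊆Poly _ γ))

    m≤ : ∀ {d} → IsDegree d → m ≤ d
    m≤ isDegree = independent⇒≤ independent poly-cong
      λ γ → F⟨x⟩⊆Poly isDegree (Equivalence.from (spans _) (γ , refl))

    result : IsDegree m
    -- The exponents 0 to `m` suffice: without a relation among them, `suc m` independent elements
    -- would lie in F(x).
    result with findDegree (suc m)
    ... | inj₁ free = contradiction (free⇒≤m free) ℕ.1+n≰n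
    ... | inj₂ (d , isDegree) =
      ≡.subst IsDegree (ℕ.≤-antisym (free⇒≤m (proj₂ isDegree)) (m≤ isDegree)) isDegree

  -- For f with lower coefficients β, homogenised in (t₀ , t₁) at T = t₁ / t₀, this is
  -- (x − T) · (f(x) − f(T)) / (x − T) = f(x) − f(T), with η = t₀ʳ⁺¹ f(T) and subtracted
  -- terms moved across.
  quotients-identity : ∀ r (β : Vector F.Carrier (suc r)) t₀ t₁ →
    let S = linearCombination (monomials r t₀ t₁) (quotients β) in
    ∃[ η ] ι t₀ * x * S + ι η ≈ ι t₁ * S + ι (t₀ ^ꟳ suc r) * monic β
  -- Here f(T) = β₀ + T, so the homogenised value `η` is t₁ + t₀ β₀.
  quotients-identity zero β t₀ t₁ = t₁ F.+ t₀ F.* β zero , (begin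
    ι t₀ * x * S + ι (t₁ F.+ t₀ F.* β zero)
      ≈⟨ +-cong (*-congˡ S≈1) (trans (ι.+-homo _ _) (+-congˡ (ι.*-homo _ _))) ⟩
    ι t₀ * x * 1# + (ι t₁ + ι t₀ * ι (β zero))
      ≈⟨ quotients-base x (ι t₀) (ι t₁) (ι (β zero)) ⟩
    ι t₁ * 1# + ι t₀ * (ι (β zero) + x * 1#)
      ≈⟨ +-cong (*-congˡ S≈1) (*-congʳ (ι.⟦⟧-cong (F.*-identityʳ t₀))) ⟨
    ι t₁ * S + ι (t₀ ^ꟳ 1) * monic β  ∎)
    where
    S = linearCombination (monomials 0 t₀ t₁) (quotients β)

    S≈1 : S ≈ 1#
    S≈1 = trans (+-identityʳ _) (trans (*-identityʳ _) (trans (ι.⟦⟧-cong (F.*-identityʳ F.1#)) ι.1#-homo))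
  quotients-identity (suc r) β t₀ t₁ with η , eq ← quotients-identity r (tail β) t₀ t₁ =
    -- The Horner step f(T) = β₀ + T g(T), multiplied by t₀ʳ⁺²; here g has lower coefficients
    -- `tail β`, and `η` is t₀ʳ⁺¹ g(T).
    t₁ F.* η F.+ t₀ F.* p F.* β zero , (begin
    ι t₀ * x * S + ι (t₁ F.* η F.+ t₀ F.* p F.* β zero)
      ≈⟨ +-cong (*-congˡ S≈) (trans (ι.+-homo _ _) (+-cong (ι.*-homo _ _)
           (trans (ι.*-homo _ _) (*-congʳ (ι.*-homo _ _))))) ⟩
    ι t₀ * x * (ι p * M + ι t₁ * S′) + (ι t₁ * ι η + ι t₀ * ι p * ι (β zero))
      ≈⟨ quotients-step x (ι t₀) (ι t₁) (ι p) M S′ (ι η) (ι (β zero)) ⟩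
    ι t₁ * (ι t₀ * x * S′ + ι η) + ι t₀ * ι p * (ι (β zero) + x * M)
      ≈⟨ +-congʳ (*-congˡ eq) ⟩
    ι t₁ * (ι t₁ * S′ + ι p * M) + ι t₀ * ι p * (ι (β zero) + x * M)
      ≈⟨ +-congʳ (*-congˡ (+-comm _ _)) ⟩
    ι t₁ * (ι p * M + ι t₁ * S′) + ι t₀ * ι p * (ι (β zero) + x * M)
      ≈⟨ +-cong (*-congˡ S≈) (*-congʳ (ι.*-homo _ _)) ⟨
    ι t₁ * S + ι (t₀ ^ꟳ suc (suc r)) * monic β  ∎)
    where
    p = t₀ ^ꟳ suc r
    M = monic (tail β)
    S′ = linearCombination (monomials r t₀ t₁) (quotients (tail β))
    S = linearCombination (monomials (suc r) t₀ t₁) (quotients β)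

    -- After t₀ʳ⁺¹, every monomial of degree r + 1 is t₁ times one of degree r.
    mon≈ : tail (monomials (suc r) t₀ t₁) ≋ (λ i → t₁ F.* monomials r t₀ t₁ i)
    mon≈ i = F.trans (F.sym (F.*-assoc t₀ᵏ t₁ t₁ᵏ))
               (F.trans (F.*-congʳ (F.*-comm t₀ᵏ t₁)) (F.*-assoc t₁ t₀ᵏ t₁ᵏ))
      where
      t₀ᵏ = t₀ ^ꟳ (r ∸ toℕ i)
      t₁ᵏ = t₁ ^ꟳ toℕ i

    S≈ : S ≈ ι p * M + ι t₁ * S′
    S≈ = +-cong (*-congʳ (ι.⟦⟧-cong (F.*-identityʳ p)))
      (trans (linearCombination-cong (quotients (tail β)) mon≈)
             (linearCombination-* (quotients (tail β)) t₁ (monomials r t₀ t₁)))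

  -- With f(x) = 0 the identity leaves only - f(T), homogenised, which lies in F. This makes the
  -- difference quotient an F-multiple of the inverse of t₀ x - t₁ whenever the latter is nonzero.
  quotients-reciprocal : ∀ r (β : Vector F.Carrier (suc r)) → monic β ≈ 0# → ∀ t₀ t₁ →
    ∃[ η ] (ι t₀ * x + ι (F.- t₁)) * linearCombination (monomials r t₀ t₁) (quotients β) ≈ ι η
  quotients-reciprocal r β monic≈0 t₀ t₁ with η , eq ← quotients-identity r β t₀ t₁ =
    F.- η , trans (GroupProperties.inverseˡ-unique +-group _ (ι η) (begin
      (ι t₀ * x + ι (F.- t₁)) * S + ι η          ≈⟨ +-congʳ (trans (distribʳ S _ _) (+-comm _ _)) ⟩
      ι (F.- t₁) * S + ι t₀ * x * S + ι η        ≈⟨ +-assoc _ _ _ ⟩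
      ι (F.- t₁) * S + (ι t₀ * x * S + ι η)      ≈⟨ +-congˡ eq ⟩
      ι (F.- t₁) * S + (ι t₁ * S + ι p * monic β)
        ≈⟨ +-congˡ (trans (+-congˡ (trans (*-congˡ monic≈0) (zeroʳ _))) (+-identityʳ _)) ⟩
      ι (F.- t₁) * S + ι t₁ * S                  ≈⟨ distribʳ S _ _ ⟨
      (ι (F.- t₁) + ι t₁) * S                    ≈⟨ *-congʳ (ι.+-homo _ _) ⟨
      ι (F.- t₁ F.+ t₁) * S                      ≈⟨ *-congʳ (trans (ι.⟦⟧-cong (F.-‿inverseˡ t₁)) ι.0#-homo) ⟩
      0# * S                                     ≈⟨ zeroˡ S ⟩
      0#                                         ∎)) (sym (ι.-‿homo η))
    where
    p = t₀ ^ꟳ suc r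
    S = linearCombination (monomials r t₀ t₁) (quotients β)

  -- The lower coefficients of the minimal polynomial are the negated coefficients of the relation
  -- for `x ^ᴸ d`.
  isDegree⇒monic≈0 : ∀ {d} → IsDegree d → ∃[ β ] monic {d} β ≈ 0#
  isDegree⇒monic≈0 ((α , xᵈ≈) , _) with β , -xᵈ≈ ← Poly-- (α , xᵈ≈) =
    β , trans (monic≈ β) (trans (+-congˡ (sym -xᵈ≈)) (-‿inverseʳ _))

-- The image under `j` of the line through Fa and Fb.

module InvertedLine {c ℓ ℓ# c′ ℓ′ ℓ#′ q q′}
  (F : FiniteField c ℓ ℓ# q) (L : FiniteField c′ ℓ′ ℓ#′ q′)
  (ι : FiniteField.Carrier F → FiniteField.Carrier L)
  (ι-mono : IsRingMonomorphism (Ring.rawRing (FiniteField.ring F)) (Ring.rawRing (FiniteField.ring L)) ι)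
  where

  private
    module F = FiniteField F
    module ι = IsRingMonomorphism ι-mono
  open FiniteField L hiding (zero)
  open FiniteFieldProperties F using (_≋_; -x≈0⇒x≈0)
  open Extension F L ι ι-mono
  open LinearAlgebra F asVectorSpace
  open SetoidReasoning setoid

  module _ (Fa Fb : Point) (Fa≉Fb : Fa ≉ₚ Fb) where

    private
      a = vector Fa
      b = vector Fb
      b⁻¹ = inv b (nonzero Fb)

    open SimpleExtension F L ι ι-mono (a * b⁻¹)

    -- Degree 0 would force 1 = 0; degree 1 would put a b⁻¹ into F, so that Fa and Fb coincide.
    isDegree⇒≥2 : ∀ {m} → IsDegree m → 2 ≤ m
    isDegree⇒≥2 {zero} ((_ , 1≈0) , _) = contradiction 1≈0 1≉0
    isDegree⇒≥2 {suc zero} ((α , x≈) , _) =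
      contradiction (∈⟨⟩⇒≐ (nonzero Fa) (α zero , a≈)) Fa≉Fb
      where
      a≈ : a ≈ ι (α zero) * b
      a≈ = begin
        a                                   ≈⟨ *-identityʳ a ⟨
        a * 1#                              ≈⟨ *-congˡ (invˡ b (nonzero Fb)) ⟨
        a * (b⁻¹ * b)                       ≈⟨ *-assoc _ _ _ ⟨
        a * b⁻¹ * b                         ≈⟨ *-congʳ (*-identityʳ _) ⟨
        a * b⁻¹ * 1# * b                    ≈⟨ *-congʳ x≈ ⟩
        (ι (α zero) + a * b⁻¹ * 0#) * b     ≈⟨ *-congʳ (trans (+-congˡ (zeroʳ _)) (+-identityʳ _)) ⟩
        ι (α zero) * b                      ∎
    isDegree⇒≥2 {suc (suc m)} _ = s≤s (s≤s z≤n)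

    module _ {r} (isDegree : IsDegree (suc r)) where

      private
        β : Vector F.Carrier (suc r)
        β = proj₁ (isDegree⇒monic≈0 isDegree)

        -- A vector on the line is `b` times t₀ x - t₁, so its inverse carries the factor `b⁻¹`;
        -- this nonzero factor preserves independence.
        v : Vector Carrier (suc r)
        v i = b⁻¹ * quotients β i

        v-independent : Independent v
        v-independent = independent-scale {v = quotients β} (inv≉0 b (nonzero Fb))
          (quotients-independent β (proj₂ isDegree))

        uple : F.Carrier → F.Carrier → Carrier
        uple t₀ t₁ = linearCombination (monomials r t₀ t₁) v

        -- The point of the line with parameters (t₀ , t₁); the sign makes its quotient
        -- by b equal to t₀ x − t₁.
        onLine : F.Carrier → F.Carrier → Carrier
        onLine t₀ t₁ = linearCombination (t₀ ∷ F.- t₁ ∷ []) (a ∷ b ∷ [])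

      -- The factors `b` and `b⁻¹` cancel, leaving the product computed in `quotients-reciprocal`.
      onLine-uple : ∀ t₀ t₁ → ∃[ η ] onLine t₀ t₁ * uple t₀ t₁ ≈ ι η
      onLine-uple t₀ t₁ =
        let η , eq = quotients-reciprocal r β (proj₂ (isDegree⇒monic≈0 isDegree)) t₀ t₁ in η , (begin
          y * uple t₀ t₁      ≈⟨ *-congˡ (linearCombination-scale b⁻¹ (quotients β) (monomials r t₀ t₁)) ⟩
          y * (b⁻¹ * S)       ≈⟨ *-assoc _ _ _ ⟨
          y * b⁻¹ * S         ≈⟨ *-congʳ (*-comm y b⁻¹) ⟩
          b⁻¹ * y * S         ≈⟨ *-congʳ (linearCombination-scale b⁻¹ (a ∷ b ∷ []) (t₀ ∷ F.- t₁ ∷ [])) ⟨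
          (ι t₀ * (b⁻¹ * a) + (ι (F.- t₁) * (b⁻¹ * b) + 0#)) * S
            ≈⟨ *-congʳ (+-cong (*-congˡ (*-comm b⁻¹ a)) (trans (+-identityʳ _)
                 (trans (*-congˡ (invˡ b (nonzero Fb))) (*-identityʳ _)))) ⟩
          (ι t₀ * (a * b⁻¹) + ι (F.- t₁)) * S  ≈⟨ eq ⟩
          ι η                 ∎)
        where
        y = onLine t₀ t₁
        S = linearCombination (monomials r t₀ t₁) (quotients β)

      -- By `onLine-uple` the vector `uple t₀ t₁` is `η` times the inverse of `vector Q`. It is
      -- nonzero because `v` is independent and the monomials do not all vanish, so the two span the
      -- same point.
      j-onLine : ∀ {t₀ t₁} → ¬ (t₀ F.≈ F.0# × t₁ F.≈ F.0#) → ∀ Q → vector Q ≈ onLine t₀ t₁ →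
                 ⟨ vector (Func.to j Q) ⟩ ≐ ⟨ uple t₀ t₁ ⟩
      j-onLine {t₀} {t₁} t≉0 Q Q≈ =
        let η , eq = onLine-uple t₀ t₁
            uple⊆ , ⊆uple = ∈⟨⟩⇒≐ uple≉0 (η , (begin
              uple t₀ t₁                     ≈⟨ *-identityˡ _ ⟨
              1# * uple t₀ t₁                ≈⟨ *-congʳ (invˡ y (nonzero Q)) ⟨
              y⁻¹ * y * uple t₀ t₁           ≈⟨ *-assoc _ _ _ ⟩
              y⁻¹ * (y * uple t₀ t₁)         ≈⟨ *-congˡ (*-congʳ Q≈) ⟩
              y⁻¹ * (onLine t₀ t₁ * uple t₀ t₁)  ≈⟨ *-congˡ eq ⟩
              y⁻¹ * ι η                      ≈⟨ *-comm _ _ ⟩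
              ι η * y⁻¹                      ∎))
        in ⊆uple , uple⊆
        where
        y = vector Q
        y⁻¹ = inv y (nonzero Q)

        uple≉0 : uple t₀ t₁ ≉ 0#
        uple≉0 uple≈0 = t≉0 (monomials≈0 r (v-independent (monomials r t₀ t₁) uple≈0))

      module _ {p} (line : Line p) (Fa∈ : Fa ∈ pointsOf line) (Fb∈ : Fb ∈ pointsOf line) where

        private
          line≐ : Line.subspace line ≐ Span (a ∷ b ∷ [])
          line≐ = line≐Span line Fa Fb Fa≉Fb Fa∈ Fb∈

          self∈ : ∀ y → y ∈ ⟨ y ⟩
          self∈ y = F.1# , sym (trans (*-congʳ ι.1#-homo) (*-identityˡ y))

        j[line]⇒uple : ∀ {P} → P ∈ j[ pointsOf line ] →
          ∃[ t₀ ] ∃[ t₁ ] ¬ (t₀ F.≈ F.0# × t₁ F.≈ F.0#) × ⟨ vector P ⟩ ≐ ⟨ uple t₀ t₁ ⟩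
        j[line]⇒uple (Q , Q∈ , P⊆ , ⊆P) =
          let γ , Q≈ = proj₁ line≐ (Q∈ (self∈ (vector Q)))
              t₀ = γ zero
              -- The sign undoes the one built into `onLine`.
              t₁ = F.- γ (suc zero)
              γ≋ : γ ≋ (t₀ ∷ F.- t₁ ∷ [])
              γ≋ = λ where
                zero       → F.refl
                (suc zero) → F.sym (GroupProperties.⁻¹-involutive F.+-group (γ (suc zero)))
              γ≉0 = λ (t₀≈0 , t₁≈0) → nonzero Q (trans Q≈ (trans
                (linearCombination-cong (a ∷ b ∷ []) {γ} {λ _ → F.0#} (λ where
                  zero       → t₀≈0
                  (suc zero) → -x≈0⇒x≈0 t₁≈0))
                (linearCombination-0 (a ∷ b ∷ []))))
              jQ⊆ , ⊆jQ = j-onLine γ≉0 Q (trans Q≈ (linearCombination-cong (a ∷ b ∷ []) γ≋))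
          in t₀ , t₁ , γ≉0 , (λ z → jQ⊆ (P⊆ z)) , (λ z → ⊆P (⊆jQ z))

        uple⇒j[line] : ∀ {P t₀ t₁} → ¬ (t₀ F.≈ F.0# × t₁ F.≈ F.0#) →
          ⟨ vector P ⟩ ≐ ⟨ uple t₀ t₁ ⟩ → P ∈ j[ pointsOf line ]
        uple⇒j[line] {P} {t₀} {t₁} t≉0 (P⊆ , ⊆P) =
          let jQ⊆ , ⊆jQ = j-onLine t≉0 Q refl
          in Q , Q∈ , (λ z → ⊆jQ (P⊆ z)) , (λ z → ⊆P (jQ⊆ z))
          where
          -- Independence of `a` and `b` makes the candidate preimage a nonzero vector.
          y≉0 : onLine t₀ t₁ ≉ 0#
          y≉0 y≈0 = t≉0 (t≈0 zero , -x≈0⇒x≈0 (t≈0 (suc zero)))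
            where t≈0 = distinct⇒independent Fa Fb Fa≉Fb (t₀ ∷ F.- t₁ ∷ []) y≈0

          Q : Point
          Q = point (onLine t₀ t₁) y≉0

          Q∈ : Q ∈ pointsOf line
          Q∈ (κ , z≈) = proj₂ line≐
            ((λ i → κ F.* (t₀ ∷ F.- t₁ ∷ []) i) , trans z≈ (sym
              (linearCombination-* (a ∷ b ∷ []) κ (t₀ ∷ F.- t₁ ∷ []))))

        j[line]-image : 1 ≤ r → IsImageOfUpleEmbedding r j[ pointsOf line ]
        j[line]-image 1≤r = 1≤r , _ , combinations-mono {v = v} v-independent , λ P →
          mk⇔ (j[line]⇒uple {P}) (λ (_ , _ , t≉0 , eq) → uple⇒j[line] {P} t≉0 eq)

mainTheorem1 :
    ∀ {c ℓ ℓ# c′ ℓ′ ℓ#′ p} (q n : ℕ) → IsPrimePower q → 2 ≤ n →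
    (F : FiniteField c ℓ ℓ# q) (L : FiniteField c′ ℓ′ ℓ#′ (q ^ n)) →
    (ι : FiniteField.Carrier F → FiniteField.Carrier L) →
    (ι-mono : IsRingMonomorphism (Ring.rawRing (FiniteField.ring F)) (Ring.rawRing (FiniteField.ring L)) ι) →
    let module L = FiniteField L
        open Extension F L ι ι-mono
    in
    (Fa Fb : Point) → Fa ≉ₚ Fb →
    (line : Line p) → Fa ∈ pointsOf line → Fb ∈ pointsOf line →
    (m : ℕ) → Degree (vector Fa L.* L.inv (vector Fb) (nonzero Fb)) m →
    IsImageOfUpleEmbedding (m ∸ 1) j[ pointsOf line ]
mainTheorem1 q n _ _ F L ι ι-mono Fa Fb Fa≉Fb line Fa∈ Fb∈ m degree =
  image m (SimpleExtension.degree⇒isDegree F L ι ι-mono _ degree)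
  where
  open Extension F L ι ι-mono
  open InvertedLine F L ι ι-mono
  open SimpleExtension F L ι ι-mono using (IsDegree)

  image : ∀ m → IsDegree _ m → IsImageOfUpleEmbedding (m ∸ 1) j[ pointsOf line ]
  -- Degree at least 2 gives `m = suc r` with `1 ≤ r`, and then `m ∸ 1` reduces to `r`.
  image m isDegree with m | isDegree⇒≥2 Fa Fb Fa≉Fb isDegree | isDegree
  ... | suc r | s≤s 1≤r | isDegree′ = j[line]-image Fa Fb Fa≉Fb isDegree′ line Fa∈ Fb∈ 1≤r
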